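{- The following is provable in $\mathrm{BZFC}$: for all sets $A$, $B$ and $C$, 1. $A\cong A$; 2. $A\cong B\Leftrightarrow B\cong A$; 3. if $A\cong B$, then $A\cong C\Leftrightarrow B\cong C$; 4. if $A\cong B$, then $A\preceq C\Leftrightarrow B\preceq C$; 5. if $A\cong B$, then $C\preceq A\Leftrightarrow C\preceq B$; 6. if $A\preceq B$ and $B\preceq C$, then $A\preceq C$.
   Context: Logic. The background logic is the four-valued first-order logic BS4 with primitives $\sim,\land,\lor,\rightarrow,\leftrightarrow,\bot,\forall,\exists$. A model has a non-empty domain $M$, the usual interpretations of constants and function symbols, and, for each $n$-ary relation symbol $R$, two independent interpretations $R^+,R^-\subseteq M^n$; $=^+$ is true identity and $=^-$ is a symmetric relation. Truth and falsity are defined simultaneously (a formula may be true, false, both, or neither): an atomic formula is true/false according to $R^+$/$R^-$; $\sim\varphi$ is true iff $\varphi$ is false, and false iff $\varphi$ is true; $\varphi\land\psi$ is true iff both are true, false iff at least one is false; $\lor$ dually; $\varphi\rightarrow\psi$ is true iff ($\varphi$ true implies $\psi$ true), false iff $\varphi$ is true and $\psi$ is false; $\varphi\leftrightarrow\psi$ is true iff ($\varphi$ true iff $\psi$ true), false iff ($\varphi$ true and $\psi$ false) or ($\varphi$ false and $\psi$ true); $\forall$ is true iff all instances are true, false iff some instance is false; $\exists$ is true iff some instance is true, false iff all instances are false; $\bot$ is false and not true. $\Gamma\vDash\varphi$ iff $\varphi$ is true in every model in which all of $\Gamma$ is true. Asserting a formula means asserting that it is true; English "iff", "if/then", "and", "or"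 between formulas concern truth. Abbreviations: $\neg\varphi:=\varphi\rightarrow\bot$ (true iff $\varphi$ is not true); $!\varphi:=\sim\neg\varphi$ (two-valued, true iff $\varphi$ is true); $?\varphi:=\neg\sim\varphi$ (two-valued, true iff $\varphi$ is not false); $\circ\varphi:=\,!\varphi\leftrightarrow ?\varphi$; $\varphi\Rightarrow\psi:=(\varphi\rightarrow\psi)\land(\sim\psi\rightarrow\sim\varphi)$; $\varphi\Leftrightarrow\psi:=(\varphi\leftrightarrow\psi)\land(\sim\varphi\leftrightarrow\sim\psi)$; $\varphi\,\&\,\psi:=\,\sim(\varphi\rightarrow\sim\psi)$; $\exists x\in A\,\varphi:=\exists x(x\in A\,\&\,\varphi)$; $\forall x\in A\,\varphi:=\forall x(x\in A\rightarrow\varphi)$. A slashed relation symbol ($\neq,\notin,\not\subseteq,\not\cong,\not\preceq$) is the $\sim$-negation of the relation. Set theory. $\mathrm{BZFC}$ is a BS4-theory in the language $\{\in,=\}$ whose objects are called sets. It includes: Extensionality $\forall A\forall B(A=B\Leftrightarrow\forall x(x\in A\Leftrightarrow x\in B))$; Comprehension $\forall A\exists B\forall x(x\in B\Leftrightarrow x\in A\land\varphi(x))$; ACLA: $\exists A(A^!\not\subseteq A^?)\land\exists A(A^?\not\subseteq A^!)$; Choice: every classical set of non-empty sets has a choice function. Here $A=\{x:\varphi(x)\}$ means $\forall x(x\in A\Leftrightarrow\varphi(x))$; $A\subseteq B:=\forall x(x\in A\Rightarrow x\in B)$; $A$ is classical if $\forall x\,{\circ}(x\in A)$; $A^!:=\{x:{!}(x\in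 A)\}$ and $A^?:=\{x:{?}(x\in A)\}$. The remaining axioms are suitable analogues of those of $\mathrm{ZFC}$; available consequences are: $A^!,A^?$ are (classical) sets; $A\subseteq B\leftrightarrow(A^!\subseteq B^!\land A^?\subseteq B^?)$, $A\not\subseteq B\leftrightarrow A^!\not\subseteq B^?$, $A=B\leftrightarrow(A^!=B^!\land A^?=B^?)$, $A\neq B\leftrightarrow(A^!\not\subseteq B^?\lor B^!\not\subseteq A^?)$; for all classical sets $X,Y$ there is a unique set $\langle X|Y\rangle$ with $\langle X|Y\rangle^!=X$, $\langle X|Y\rangle^?=Y$; ordered pairs are encoded so that $(a,b)=(c,d)\Leftrightarrow(a=c\land b=d)$; usual $\mathrm{ZFC}$ set theory (including choice and von Neumann ordinals, which live in the inner $\mathrm{ZFC}$-model of hereditarily classical sets) applies to classical sets, whose elements may be arbitrary sets. Put $\mathrm{rlm}(A):=A^!\cup A^?$ (a classical set). Functions and equinumerosity. A classical function is a classical set $f$ of ordered pairs with $((a,b)\in f\land(a,c)\in f)\rightarrow{!}(b=c)$; it is an injection if $((a,c)\in f\land(b,c)\in f)\rightarrow{!}(a=b)$. For $A\subseteq\mathrm{dom}(f)$, $f[A]:=\{y:\exists x(y=f(x)\,\&\,x\in A)\}$, so $f[A]^!=f[A^!]$ and $f[A]^?=f[A^?]$. A counting of $A$ is an injection with domain $\mathrm{rlm}(A)$; $\mathrm{Count}(A)$ is the class of countings of $A$. Define $$A\cong B:=\exists f\in\mathrm{Count}(A)\,\exists g\in\mathrm{Count}(B)\,(f[A]=g[B]),$$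 $$A\preceq B:=\exists f\in\mathrm{Count}(A)\,\exists g\in\mathrm{Count}(B)\,(f[A]\subseteq g[B]).$$ Thus $A\not\cong B$ (resp. $A\not\preceq B$) is true iff $f[A]\neq g[B]$ (resp. $f[A]\not\subseteq g[B]$) is true for all $f\in\mathrm{Count}(A)$, $g\in\mathrm{Count}(B)$. -}

module Defs where

open import Level using (Level) renaming (suc to lsuc)
open import Data.Nat using (ℕ; zero; suc; _+_)
open import Data.Fin using (Fin; zero; suc; lift)
  renaming (_↑ʳ_ to infixr 11 _↑ʳ_)
open import Data.Vec using (Vec; []; _∷_; lookup)
open import Data.Product using (Σ; _×_)
open import Data.Sum using (_⊎_)
open import Data.Empty.Polymorphic using (⊥)
open import Data.Unit.Polymorphic using (⊤)
open import Relation.Binary.PropositionalEquality using (_≡_)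

private variable
  m n : ℕ

infix  10 _`∈_ _`=_
infixr 9 `∼_
infixr 8 _`∧_
infixr 7 _`∨_
infixr 5 _`→_
infix  4 _`↔_
infixr 9 `∀_ `∃_

-- BS4 in the language {∈, =}, with de Bruijn indices: in the scope of a
-- quantifier, v0 is the variable it binds and 1 ↑ʳ i is the variable called i
-- outside.  There are no function symbols, so variables are the only terms.
data Formula (n : ℕ) : Set where
  _`∈_ _`=_           : Fin n → Fin n → Formula n
  `⊥                  : Formula n
  `∼_                 : Formula n → Formula n
  _`∧_ _`∨_ _`→_ _`↔_ : Formula n → Formula n → Formula n
  `∀_ `∃_             : Formula (suc n) → Formula n

Sentence : Set
Sentence = Formula 0

pattern v0 = zero
pattern v1 = suc zero
pattern v2 = suc (suc zero)

rename : (Fin m → Fin n) → Formula m → Formula n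
rename ρ (x `∈ y) = ρ x `∈ ρ y
rename ρ (x `= y) = ρ x `= ρ y
rename ρ `⊥       = `⊥
rename ρ (`∼ φ)   = `∼ rename ρ φ
rename ρ (φ `∧ ψ) = rename ρ φ `∧ rename ρ ψ
rename ρ (φ `∨ ψ) = rename ρ φ `∨ rename ρ ψ
rename ρ (φ `→ ψ) = rename ρ φ `→ rename ρ ψ
rename ρ (φ `↔ ψ) = rename ρ φ `↔ rename ρ ψ
rename ρ (`∀ φ)   = `∀ rename (lift 1 ρ) φ
rename ρ (`∃ φ)   = `∃ rename (lift 1 ρ) φ

∀* : Formula n → Sentence
∀* {zero}  φ = φ
∀* {suc n} φ = ∀* (`∀ φ)

-- =⁺ is the identity of Carrier and needs no field.
record Model (ℓ : Level) : Set (lsuc ℓ) where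
  infix 4 _∈⁺_ _∈⁻_ _=⁻_
  field
    Carrier        : Set ℓ
    element        : Carrier
    _∈⁺_ _∈⁻_ _=⁻_ : Carrier → Carrier → Set ℓ
    =⁻-sym         : ∀ {a b} → a =⁻ b → b =⁻ a

module _ {ℓ} (𝔐 : Model ℓ) where
  open Model 𝔐

  True False : Formula n → Vec Carrier n → Set ℓ

  True (x `∈ y) ρ = lookup ρ x ∈⁺ lookup ρ y
  True (x `= y) ρ = lookup ρ x ≡ lookup ρ y
  True `⊥       ρ = ⊥
  True (`∼ φ)   ρ = False φ ρ
  True (φ `∧ ψ) ρ = True φ ρ × True ψ ρ
  True (φ `∨ ψ) ρ = True φ ρ ⊎ True ψ ρ
  True (φ `→ ψ) ρ = True φ ρ → True ψ ρ
  True (φ `↔ ψ) ρ = (True φ ρ → True ψ ρ) × (True ψ ρ → True φ ρ)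
  True (`∀ φ)   ρ = (a : Carrier) → True φ (a ∷ ρ)
  True (`∃ φ)   ρ = Σ Carrier λ a → True φ (a ∷ ρ)

  False (x `∈ y) ρ = lookup ρ x ∈⁻ lookup ρ y
  False (x `= y) ρ = lookup ρ x =⁻ lookup ρ y
  False `⊥       ρ = ⊤
  False (`∼ φ)   ρ = True φ ρ
  False (φ `∧ ψ) ρ = False φ ρ ⊎ False ψ ρ
  False (φ `∨ ψ) ρ = False φ ρ × False ψ ρ
  False (φ `→ ψ) ρ = True φ ρ × False ψ ρ
  False (φ `↔ ψ) ρ = (True φ ρ × False ψ ρ) ⊎ (False φ ρ × True ψ ρ)
  False (`∀ φ)   ρ = Σ Carrier λ a → False φ (a ∷ ρ)
  False (`∃ φ)   ρ = (a : Carrier) → False φ (a ∷ ρ)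

Theory : Set₁
Theory = Sentence → Set

infix 2 _⊨[_]_

-- Consequence over the models whose domain lives in Set ℓ.
_⊨[_]_ : Theory → (ℓ : Level) → Sentence → Set (lsuc ℓ)
Γ ⊨[ ℓ ] φ = (𝔐 : Model ℓ) → (∀ {γ} → Γ γ → True 𝔐 γ []) → True 𝔐 φ []

infixr 9 `¬_ `!_ `?_ `∘_
infixr 8 _`&_
infix  4 _`⇒_ _`⇔_

`¬_ `!_ `?_ `∘_ : Formula n → Formula n
`¬ φ = φ `→ `⊥
`! φ = `∼ `¬ φ
`? φ = `¬ `∼ φ
`∘ φ = `! φ `↔ `? φ

_`⇒_ _`⇔_ _`&_ : Formula n → Formula n → Formula n
φ `⇒ ψ = (φ `→ ψ) `∧ (`∼ ψ `→ `∼ φ)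
φ `⇔ ψ = (φ `↔ ψ) `∧ (`∼ φ `↔ `∼ ψ)
φ `& ψ = `∼ (φ `→ `∼ ψ)

infixr 9 `∀∈[_]_ `∃∈[_]_

`∀∈[_]_ `∃∈[_]_ : Fin n → Formula (suc n) → Formula n
`∀∈[ A ] φ = `∀ (v0 `∈ 1 ↑ʳ A `→ φ)
`∃∈[ A ] φ = `∃ (v0 `∈ 1 ↑ʳ A `& φ)

-- A class term {x : φ(x)}; the variable x is v0.
Class : ℕ → Set
Class n = Formula (suc n)

infix 10 _`=⟦_⟧

-- A = {x : φ(x)}.  Elsewhere a term t defined by abstraction is eliminated by
-- reading ψ(t) as ∃ X (X = t & ψ(X)); a ∈ {x : φ(x)} is written φ(a).
_`=⟦_⟧ : Fin n → Class n → Formula n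
A `=⟦ φ ⟧ = `∀ (v0 `∈ 1 ↑ʳ A `⇔ φ)

infix 10 _`⊆_ _^! _^?

_`⊆_ : Fin n → Fin n → Formula n
A `⊆ B = `∀ (v0 `∈ 1 ↑ʳ A `⇒ v0 `∈ 1 ↑ʳ B)

`Classical : Fin n → Formula n
`Classical A = `∀ `∘ (v0 `∈ 1 ↑ʳ A)

`∅ : Class n
`∅ = `⊥

_^! _^? rlm : Fin n → Class n
A ^!  = `! (v0 `∈ 1 ↑ʳ A)
A ^?  = `? (v0 `∈ 1 ↑ʳ A)
rlm A = A ^! `∨ A ^?

-- Classical singletons and doubletons: the `! matters, since in the
-- presence of incomplete sets {x : x = a} may fail to be a set (a proper
-- class of x may be such that x = a is not false).
singleton : Fin n → Class n
singleton a = `! (v0 `= 1 ↑ʳ a)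

doubleton : Fin n → Fin n → Class n
doubleton a b = `! (v0 `= 1 ↑ʳ a) `∨ `! (v0 `= 1 ↑ʳ b)

-- Kuratowski pairs formed with these only satisfy
-- (a,b) = (c,d) ↔ (a = c ∧ b = d).  To get ⇔, take the disjoint union
--   (a,b) = { {∅,{x}} : x ∈ a } ∪ { {x} : x ∈ b },
-- in which x ∈ a and x ∈ b keep their truth and falsity.
`left `right : Fin n → Fin n → Formula n
`left t x = `∃ (v0 `=⟦ `∅ ⟧ `&
            `∃ (v0 `=⟦ singleton (2 ↑ʳ x) ⟧ `&
                2 ↑ʳ t `=⟦ doubleton v1 v0 ⟧))
`right t x = t `=⟦ singleton x ⟧

pair : Fin n → Fin n → Class n
pair a b = (`∃ (`left v1 v0 `& v0 `∈ 2 ↑ʳ a)) `∨ (`∃ (`right v1 v0 `& v0 `∈ 2 ↑ʳ b))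

infix 10 ⟨_,_⟩`∈_

⟨_,_⟩`∈_ : Fin n → Fin n → Fin n → Formula n
⟨ a , b ⟩`∈ f = `∃ (v0 `=⟦ pair (1 ↑ʳ a) (1 ↑ʳ b) ⟧ `& v0 `∈ 1 ↑ʳ f)

`Function `Injection : Fin n → Formula n
`Function f =
  `Classical f `∧
  (`∀∈[ f ] `∃ `∃ v2 `=⟦ pair v1 v0 ⟧) `∧
  (`∀ `∀ `∀ ((⟨ v2 , v1 ⟩`∈ 3 ↑ʳ f `∧ ⟨ v2 , v0 ⟩`∈ 3 ↑ʳ f) `→ `! (v1 `= v0)))
`Injection f =
  `Function f `∧
  (`∀ `∀ `∀ ((⟨ v2 , v0 ⟩`∈ 3 ↑ʳ f `∧ ⟨ v1 , v0 ⟩`∈ 3 ↑ʳ f) `→ `! (v2 `= v1)))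

dom : Fin n → Class n
dom f = `∃ ⟨ v1 , v0 ⟩`∈ 2 ↑ʳ f

-- f[A]; here y = f(x) is rendered (x,y) ∈ f, and only its truth matters
-- because it stands to the left of &.
image : Fin n → Fin n → Class n
image f A = `∃ (⟨ v0 , v1 ⟩`∈ 2 ↑ʳ f `& v0 `∈ 2 ↑ʳ A)

`Count : Fin n → Fin n → Formula n
`Count f A =
  `Injection f `∧ (`∃ (v0 `=⟦ rlm (1 ↑ʳ A) ⟧ `& v0 `=⟦ dom (1 ↑ʳ f) ⟧))

infix 10 _`≅_ _`≼_

_`≅_ _`≼_ : Fin n → Fin n → Formula n
A `≅ B =
  `∃ (`Count v0 (1 ↑ʳ A) `&
  `∃ (`Count v0 (2 ↑ʳ B) `&
  `∃ (v0 `=⟦ image v2 (3 ↑ʳ A) ⟧ `&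
  `∃ (v0 `=⟦ image v2 (4 ↑ʳ B) ⟧ `&
      v1 `= v0))))
A `≼ B =
  `∃ (`Count v0 (1 ↑ʳ A) `&
  `∃ (`Count v0 (2 ↑ʳ B) `&
  `∃ (v0 `=⟦ image v2 (3 ↑ʳ A) ⟧ `&
  `∃ (v0 `=⟦ image v2 (4 ↑ʳ B) ⟧ `&
      v1 `⊆ v0))))

Extensionality : Sentence
Extensionality =
  `∀ `∀ (v1 `= v0 `⇔ (`∀ (v0 `∈ v2 `⇔ v0 `∈ v1)))

-- In φ, v0 is x, v1 is A, and the n further variables are parameters.
Comprehension : Formula (2 + n) → Sentence
Comprehension φ =
  ∀* (`∀ `∃ `∀ (v0 `∈ v1 `⇔ (v0 `∈ v2 `∧ rename (lift 1 suc) φ)))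

Pairing : Sentence
Pairing = `∀ `∀ `∃ v0 `=⟦ doubleton v2 v1 ⟧

Union : Sentence
Union = `∀ `∃ `∀ (v0 `∈ v1 `⇔ (`∃ (v0 `∈ 1 ↑ʳ v2 `∧ v1 `∈ v0)))

-- Classical, because {x : x ⊆ A} may fail to be a set.
Powerset : Sentence
Powerset = `∀ `∃ `∀ (v0 `∈ v1 `⇔ `! (v0 `⊆ v2))

-- Makes A^! and A^? sets, by comprehension from B.
ClassicalSuperset : Sentence
ClassicalSuperset = `∀ `∃ (`Classical v0 `∧ v1 `⊆ v0)

Infinity : Sentence
Infinity =
  `∃ ((`∃ (v0 `=⟦ `∅ ⟧ `& v0 `∈ v1)) `∧
      (`∀∈[ v0 ] `∃ (v0 `=⟦ v0 `∈ v2 `∨ `! (v0 `= v2) ⟧ `& v0 `∈ v2)))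

-- In φ, v0 is x, v1 is y, v2 is A, and the rest are parameters:
--   ∀y ∀z ∀x∈A (φ(x,y) ∧ φ(x,z) → y = z) → ∃B ∀y (y ∈ B ⇔ ∃x∈A !φ(x,y)).
Replacement : Formula (3 + n) → Sentence
Replacement φ =
  ∀* (`∀ ((`∀ `∀ `∀∈[ v2 ]
            ((rename (lift 1 suc) φ `∧ rename (lift 2 suc) φ) `→ v2 `= v1))
          `→
          (`∃ `∀ (v0 `∈ v1 `⇔ (`∃∈[ v2 ] `! rename (lift 2 suc) φ)))))

Foundation : Sentence
Foundation =
  `∀ ((`∃ v0 `∈ v1) `→
      (`∃ (v0 `∈ v1 `∧ (`∀ (rlm v0 `→ `¬ (v0 `∈ v2))))))

Choice : Sentence
Choice =
  `∀ ((`Classical v0 `∧ (`∀∈[ v0 ] `∃ v0 `∈ v1))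
      `→
      (`∃ (`Function v0 `∧ v1 `=⟦ dom v0 ⟧ `∧
           (`∀∈[ v1 ] `∃ (⟨ v1 , v0 ⟩`∈ v2 `∧ v0 `∈ v1)))))

ACLA : Sentence
ACLA =
  (`∃ `∃ (v0 `=⟦ v1 ^! ⟧ `& `∃ (v0 `=⟦ v2 ^? ⟧ `& `∼ v1 `⊆ v0))) `∧
  (`∃ `∃ (v0 `=⟦ v1 ^! ⟧ `& `∃ (v0 `=⟦ v2 ^? ⟧ `& `∼ v0 `⊆ v1)))

data BZFC : Theory where
  extensionality    : BZFC Extensionality
  comprehension     : (φ : Formula (2 + n)) → BZFC (Comprehension φ)
  pairing           : BZFC Pairing
  union             : BZFC Union
  powerset          : BZFC Powerset
  classicalSuperset : BZFC ClassicalSuperset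
  infinity          : BZFC Infinity
  replacement       : (φ : Formula (3 + n)) → BZFC (Replacement φ)
  foundation        : BZFC Foundation
  choice            : BZFC Choice
  acla              : BZFC ACLA

{-# OPTIONS --safe #-}
module Submission where

open import Defs
open import Axiom.ExcludedMiddle using (ExcludedMiddle)
open import Data.Empty.Polymorphic using (⊥; ⊥-elim)
open import Data.Fin using (#_)
open import Data.Product using (Σ; _×_; _,_; proj₁; proj₂)
open import Data.Sum using (_⊎_; inj₁; inj₂) renaming ([_,_]′ to [_,_])
open import Data.Unit.Polymorphic using (⊤)
open import Data.Vec using ([]; _∷_)
open import Function using (flip; id; _∘_)
open import Relation.Binary.PropositionalEquality using (_≡_; refl; sym; trans; subst)
open import Relation.Nullary using (yes; no; contradiction)

-- Everything is computed inside a model, where a counting f of A matters only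
-- through the relation "(x , y) ∈ f is true".  If f and g count A and B with
-- f[A] ⊆ g[B], then g⁻¹ ∘ f maps rlm(A) into rlm(B), so every counting h of B
-- yields the counting h ∘ g⁻¹ ∘ f of A, whose image lies in h[B].  If
-- f[A] = g[B], then the two images coincide; hence A and B have the same images
-- under countings, and can be exchanged in the truth and in the falsity
-- conditions of ≅ and ≼.

module _ {ℓ} (em : ExcludedMiddle ℓ) (𝔐 : Model ℓ)
         (axiom : ∀ {γ} → BZFC γ → True 𝔐 γ []) where
  open Model 𝔐

  private variable
    a b c d f g h p q s x x′ y y′ z w A B C D X Y Z : Carrier

  infix 0 _↔_
  _↔_ : Set ℓ → Set ℓ → Set ℓ
  P ↔ Q = (P → Q) × (Q → P)

  -- Truth and falsity conditions of the set-theoretic notions.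

  _⊆⁺_ _⊆⁻_ : Carrier → Carrier → Set ℓ
  X ⊆⁺ Y = True  𝔐 (v0 `⊆ v1) (X ∷ Y ∷ [])
  X ⊆⁻ Y = False 𝔐 (v0 `⊆ v1) (X ∷ Y ∷ [])

  IsSingleton IsRlm IsLeft IsRight : Carrier → Carrier → Set ℓ
  IsSingleton s a = True 𝔐 (v0 `=⟦ singleton v1 ⟧) (s ∷ a ∷ [])
  IsRlm D A       = True 𝔐 (v0 `=⟦ rlm v1 ⟧) (D ∷ A ∷ [])
  IsLeft z x      = True 𝔐 (`left v0 v1) (z ∷ x ∷ [])
  IsRight z x     = True 𝔐 (`right v0 v1) (z ∷ x ∷ [])

  IsPair : Carrier → Carrier → Carrier → Set ℓ
  IsPair p a b = True 𝔐 (v0 `=⟦ pair v1 v2 ⟧) (p ∷ a ∷ b ∷ [])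

  -- Opaque, so that f, x, y and A are inferred from Maps f x y and IsCounting f A.
  opaque
    Maps : Carrier → Carrier → Carrier → Set ℓ
    Maps f x y = True 𝔐 (⟨ v1 , v2 ⟩`∈ v0) (f ∷ x ∷ y ∷ [])

    IsCounting : Carrier → Carrier → Set ℓ
    IsCounting f A = True 𝔐 (`Count v0 v1) (f ∷ A ∷ [])

  -- The condition `X =⟦ image f A ⟧`, evaluated. Falsity of `&` is an implication from the truth of
  -- its left side, so only the truth of `Maps` occurs, even in the clause for `∈⁻`.
  IsImage : Carrier → Carrier → Carrier → Set ℓ
  IsImage X f A = ∀ y →
    (y ∈⁺ X ↔ Σ Carrier λ x → Maps f x y × x ∈⁺ A) ×
    (y ∈⁻ X ↔ ∀ x → Maps f x y → x ∈⁻ A)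

  -- Extensionality and the two tags used in ordered pairs.

  extensional : (∀ x → (x ∈⁺ a ↔ x ∈⁺ b) × (x ∈⁻ a ↔ x ∈⁻ b)) → a ≡ b
  extensional = proj₂ (proj₁ (axiom extensionality _ _))

  abstraction-unique : {P N : Carrier → Set ℓ} →
    (∀ x → (x ∈⁺ a ↔ P x) × (x ∈⁻ a ↔ N x)) →
    (∀ x → (x ∈⁺ b ↔ P x) × (x ∈⁻ b ↔ N x)) → a ≡ b
  abstraction-unique α β = extensional λ x →
    let (p , p′) , n , n′ = α x
        (q , q′) , m , m′ = β x
    in (q′ ∘ p , p′ ∘ q) , m′ ∘ n , n′ ∘ m

  singleton-exists : ∀ a → Σ Carrier λ s → IsSingleton s a
  singleton-exists a =
    let s , σ = axiom pairing a a
    in s , λ x → let (p , p′) , n , n′ = σ x in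
      ([ id , id ] ∘ p , p′ ∘ inj₁) , proj₁ ∘ n , λ i → n′ (i , i)

  left-exists : ∀ x → Σ Carrier λ z → IsLeft z x
  left-exists x =
    -- The empty set is extracted from Infinity.
    let _ , (e , isEmpty , _) , _ = axiom infinity
        s , isSingleton = singleton-exists x
        z , isDoubleton = axiom pairing e s
    in z , e , isEmpty , s , isSingleton , isDoubleton

  left-unique : IsLeft y x → IsLeft z x → y ≡ z
  left-unique (e , α , s , β , γ) (e′ , α′ , s′ , β′ , γ′)
    with refl ← abstraction-unique α α′ | refl ← abstraction-unique β β′ = abstraction-unique γ γ′

  -- The element {x} of {∅,{y}} is inhabited, so it is not ∅ and must be {y}.
  left-injective : IsLeft z x → IsLeft z y → x ≡ y
  left-injective {x = x} (e , α , s , β , γ) (e′ , α′ , s′ , β′ , γ′)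
    with proj₁ (proj₁ (γ′ s)) (proj₂ (proj₁ (γ s)) (inj₂ (refl , _)))
  ... | inj₁ (refl , _) = ⊥-elim (proj₁ (proj₁ (α′ x)) (proj₂ (proj₁ (β x)) (refl , _)))
  ... | inj₂ (refl , _) = proj₁ (proj₁ (proj₁ (β′ x)) (proj₂ (proj₁ (β x)) (refl , _)))

  right-injective : IsRight z x → IsRight z y → x ≡ y
  right-injective {x = x} α β = proj₁ (proj₁ (proj₁ (β x)) (proj₂ (proj₁ (α x)) (refl , _)))

  -- {∅,{x}} = {y} would make both ∅ and {x} equal to y.
  left-right-disjoint : IsLeft z x → IsRight z y → ⊥ {ℓ}
  left-right-disjoint {x = x} (e , α , s , β , γ) δ
    with proj₁ (proj₁ (δ e)) (proj₂ (proj₁ (γ e)) (inj₁ (refl , _)))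
       | proj₁ (proj₁ (δ s)) (proj₂ (proj₁ (γ s)) (inj₂ (refl , _)))
  ... | refl , _ | refl , _ = proj₁ (proj₁ (α x)) (proj₂ (proj₁ (β x)) (refl , _))

  -- Existence and injectivity of ordered pairs.

  union-exists : ∀ a b → Σ Carrier λ u → ∀ x →
    (x ∈⁺ u ↔ x ∈⁺ a ⊎ x ∈⁺ b) × (x ∈⁻ u ↔ x ∈⁻ a × x ∈⁻ b)
  union-exists a b with axiom pairing a b
  ... | d , δ with axiom union d
  ... | u , υ = u , λ x → (member⇒ , member⇐) , nonmember⇒ , nonmember⇐
    where
    a∈d : a ∈⁺ d
    a∈d = proj₂ (proj₁ (δ a)) (inj₁ (refl , _))

    b∈d : b ∈⁺ d
    b∈d = proj₂ (proj₁ (δ b)) (inj₂ (refl , _))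

    member⇒ : x ∈⁺ u → x ∈⁺ a ⊎ x ∈⁺ b
    member⇒ {x} x∈u with proj₁ (proj₁ (υ x)) x∈u
    ... | y , y∈d , x∈y with proj₁ (proj₁ (δ y)) y∈d
    ... | inj₁ (refl , _) = inj₁ x∈y
    ... | inj₂ (refl , _) = inj₂ x∈y

    member⇐ : x ∈⁺ a ⊎ x ∈⁺ b → x ∈⁺ u
    member⇐ (inj₁ x∈a) = proj₂ (proj₁ (υ _)) (a , a∈d , x∈a)
    member⇐ (inj₂ x∈b) = proj₂ (proj₁ (υ _)) (b , b∈d , x∈b)

    nonmember⇒ : x ∈⁻ u → x ∈⁻ a × x ∈⁻ b
    nonmember⇒ {x} x∈⁻u =
      -- The doubleton `d` is classical: `a ∈⁻ d` would refute `a ≡ a`, which leaves `x ∈⁻ a`.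
      [ (λ a∈⁻d → ⊥-elim (proj₁ (proj₁ (proj₂ (δ a)) a∈⁻d) refl)) , id ]
        (proj₁ (proj₂ (υ x)) x∈⁻u a) ,
      [ (λ b∈⁻d → ⊥-elim (proj₂ (proj₁ (proj₂ (δ b)) b∈⁻d) refl)) , id ]
        (proj₁ (proj₂ (υ x)) x∈⁻u b)

    nonmember⇐ : x ∈⁻ a × x ∈⁻ b → x ∈⁻ u
    nonmember⇐ {x} (x∈⁻a , x∈⁻b) = proj₂ (proj₂ (υ x)) split
      where
      split : ∀ y → y ∈⁻ d ⊎ x ∈⁻ y
      split y with em {y ≡ a} | em {y ≡ b}
      ... | yes refl | _        = inj₂ x∈⁻a
      ... | no _     | yes refl = inj₂ x∈⁻b
      ... | no y≢a   | no y≢b   = inj₁ (proj₂ (proj₂ (δ y))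
        ((λ i → contradiction i y≢a) , λ i → contradiction i y≢b))

  classical-nonmember : True 𝔐 (`Classical v0) (A ∷ []) → (x ∈⁺ A → ⊥ {ℓ}) → x ∈⁻ A
  classical-nonmember {A} {x} classical x∉A with em {x ∈⁻ A}
  ... | yes x∈⁻A = x∈⁻A
  ... | no ¬x∈⁻A = ⊥-elim (x∉A (proj₁ (proj₂ (classical x) λ x∈⁻A → contradiction x∈⁻A ¬x∈⁻A)))

  -- Comprehension needs a bounding set `u`, and `z ∈⁻ u` must already falsify the defining
  -- condition. So Replacement applies the tags to classical supersets: if `z ∈⁻ u` and `z` is the
  -- left tag of `x`, then `x` is not in `a′`, whence `x ∈⁻ a` by the falsity half of a ⊆ a′;
  -- likewise on the right.
  pair-exists : ∀ a b → Σ Carrier λ p → IsPair p a b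
  pair-exists a b =
    let a′ , a′-classical , a⊆a′ = axiom classicalSuperset a
        b′ , b′-classical , b⊆b′ = axiom classicalSuperset b
        l , l-spec = axiom (replacement {0} (`left v1 v0)) a′ λ y z x _ (α , β) → left-unique α β
        r , r-spec = axiom (replacement {0} (`right v1 v0)) b′ λ y z x _ (α , β) →
          abstraction-unique α β
        u , u-spec = union-exists l r
        p , p-spec = axiom (comprehension {2} (pair v1 v2)) b a u
    in p , λ z →
      let (s , s′) , n , n′ = p-spec z
          (m , m′) , k , _ = u-spec z
          (_ , i′) , j , _ = l-spec z
          (_ , h′) , o , _ = r-spec z
      in
      ( proj₂ ∘ s
      , λ i → s′ (m′ ([ (λ (x , α , x∈a) → inj₁ (i′ (x , proj₁ (a⊆a′ x) x∈a , α , _)))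
                      , (λ (x , α , x∈b) → inj₂ (h′ (x , proj₁ (b⊆b′ x) x∈b , α , _))) ] i) , i))
      , [ (λ z∈⁻u →
            (λ x α → proj₂ (a⊆a′ x) (classical-nonmember a′-classical
              λ x∈a′ → j (proj₁ (k z∈⁻u)) x x∈a′ α))
          , (λ x α → proj₂ (b⊆b′ x) (classical-nonmember b′-classical
              λ x∈b′ → o (proj₂ (k z∈⁻u)) x x∈b′ α)))
        , id ] ∘ n
      , n′ ∘ inj₂

  -- Tags are injective and disjoint, so membership in `p` of the tagged copy of `x` has the same
  -- truth and the same falsity as membership of `x` in the coordinate. Extensionality needs both.
  pair-injective : IsPair p a b → IsPair p c d → a ≡ c × b ≡ d
  pair-injective π ρ =
    extensional (λ x → (left⁺ π ρ , left⁺ ρ π) , left⁻ π ρ , left⁻ ρ π) ,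
    extensional (λ x → (right⁺ π ρ , right⁺ ρ π) , right⁻ π ρ , right⁻ ρ π)
    where
    left⁺ : IsPair p a b → IsPair p c d → x ∈⁺ a → x ∈⁺ c
    left⁺ {x = x} π ρ x∈a with left-exists x
    ... | z , α with proj₁ (proj₁ (ρ z)) (proj₂ (proj₁ (π z)) (inj₁ (x , α , x∈a)))
    ... | inj₁ (y , β , y∈c) = subst (_∈⁺ _) (left-injective β α) y∈c
    ... | inj₂ (y , β , _)   = ⊥-elim (left-right-disjoint α β)

    left⁻ : IsPair p a b → IsPair p c d → x ∈⁻ a → x ∈⁻ c
    left⁻ {x = x} π ρ x∈⁻a =
      let z , α = left-exists x in
      proj₁ (proj₁ (proj₂ (ρ z)) (proj₂ (proj₂ (π z))
        ( (λ y β → subst (_∈⁻ _) (left-injective α β) x∈⁻a)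
        , λ y β → ⊥-elim (left-right-disjoint α β)))) x α

    right⁺ : IsPair p a b → IsPair p c d → x ∈⁺ b → x ∈⁺ d
    right⁺ {x = x} π ρ x∈b with singleton-exists x
    ... | z , α with proj₁ (proj₁ (ρ z)) (proj₂ (proj₁ (π z)) (inj₂ (x , α , x∈b)))
    ... | inj₁ (y , β , _)   = ⊥-elim (left-right-disjoint β α)
    ... | inj₂ (y , β , y∈d) = subst (_∈⁺ _) (right-injective β α) y∈d

    right⁻ : IsPair p a b → IsPair p c d → x ∈⁻ b → x ∈⁻ d
    right⁻ {x = x} π ρ x∈⁻b =
      let z , α = singleton-exists x in
      proj₂ (proj₁ (proj₂ (ρ z)) (proj₂ (proj₂ (π z))
        ( (λ y β → ⊥-elim (left-right-disjoint β α))
        , λ y β → subst (_∈⁻ _) (right-injective α β) x∈⁻b))) x α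

  -- The realm of a set and the domain of a counting.

  rlm-exists : ∀ A → Σ Carrier λ D → IsRlm D A
  rlm-exists A =
    let A′ , A′-classical , A⊆A′ = axiom classicalSuperset A
        D , D-spec = axiom (comprehension {1} (rlm v1)) A A′
    in D , λ x →
      let (m , m′) , n , n′ = D-spec x in
      ( proj₂ ∘ m
      , λ i → m′ ( [ (λ x∈A → proj₁ (A⊆A′ x) (proj₁ x∈A))
                   -- Nonmembership in `A′` would pass down to `A`; so `x` is not a nonmember of the
                   -- classical `A′`, hence is a member.
                   , (λ x∉⁻A → proj₁ (proj₂ (A′-classical x) (x∉⁻A ∘ proj₂ (A⊆A′ x)))) ] i
                 , i))
      , [ (λ x∈⁻A′ → (λ x∈A → proj₁ (A′-classical x) (proj₁ (A⊆A′ x) x∈A , _) x∈⁻A′)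
                   , proj₂ (A⊆A′ x) x∈⁻A′ , _)
        , id ] ∘ n
      , n′ ∘ inj₂

  InRlm : Carrier → Carrier → Set ℓ
  InRlm A x = True 𝔐 (rlm v0) (x ∷ A ∷ [])

  -- The case split behind the falsity clauses: outside the common domain of all countings of `A`,
  -- membership in `A` is false anyway.
  nonmember-or-inRlm : ∀ A x → x ∈⁻ A ⊎ InRlm A x
  nonmember-or-inRlm A x with em {x ∈⁻ A}
  ... | yes x∈⁻A = inj₁ x∈⁻A
  ... | no ¬x∈⁻A = inj₂ (inj₂ λ x∈⁻A → contradiction x∈⁻A ¬x∈⁻A)

  opaque
    unfolding Maps IsCounting

    functional : IsCounting f A → Maps f x y → Maps f x z → y ≡ z
    functional (((_ , _ , φ) , _) , _) m m′ = proj₁ (φ _ _ _ (m , m′))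

    injective : IsCounting f A → Maps f x z → Maps f y z → x ≡ y
    injective ((_ , φ) , _) m m′ = proj₁ (φ _ _ _ (m , m′))

    total : IsCounting f A → InRlm A x → Σ Carrier λ y → Maps f x y
    total (_ , D , α , β) i = proj₁ (proj₁ (β _)) (proj₂ (proj₁ (α _)) i)

    inRlm : IsCounting f A → Maps f x y → InRlm A x
    inRlm (_ , D , α , β) m = proj₁ (proj₁ (α _)) (proj₂ (proj₁ (β _)) (_ , m))

  -- Graphs of functional relations, obtained by Replacement.

  module _ (R : Carrier → Carrier → Set ℓ) where

    InGraph : Carrier → Carrier → Set ℓ
    InGraph x p = Σ Carrier λ y → IsPair p x y × R x y

    -- Shaped exactly as the conclusion of Replacement evaluates: the `⊤` and the negation in the
    -- second clause come from its `!`.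
    IsGraph : Carrier → Carrier → Set ℓ
    IsGraph f D = ∀ p →
      (p ∈⁺ f ↔ Σ Carrier λ x → x ∈⁺ D × InGraph x p × ⊤ {ℓ}) ×
      (p ∈⁻ f ↔ ∀ x → x ∈⁺ D → InGraph x p → ⊥ {ℓ})

  module _ (R : Carrier → Carrier → Set ℓ)
           (R-functional : ∀ {x y z} → R x y → R x z → y ≡ z) where

    -- The single-valuedness demanded by Replacement, for the map from x to the pair (x,y) rather
    -- than to y; its set of values is then the graph itself.
    inGraph-functional : InGraph R x p × InGraph R x q → p ≡ q
    inGraph-functional ((_ , π , r) , (_ , ρ , s))
      with refl ← R-functional r s = abstraction-unique π ρ

    module _ {f D} (graph : IsGraph R f D) where

      opaque
        unfolding Maps

        maps⇒ : Maps f x y → x ∈⁺ D × R x y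
        maps⇒ (p , π , p∈f) with proj₁ (proj₁ (graph p)) p∈f
        ... | _ , x∈D , (_ , ρ , r) , _ with pair-injective π ρ
        ... | refl , refl = x∈D , r

        maps⇐ : x ∈⁺ D → R x y → Maps f x y
        maps⇐ {x} {y} x∈D r =
          let p , π = pair-exists x y in p , π , proj₂ (proj₁ (graph p)) (x , x∈D , (y , π , r) , _)

      graph-classical : True 𝔐 (`Classical v0) (f ∷ [])
      graph-classical p = consistent , complete
        where
        consistent : True 𝔐 (`! (v0 `∈ v1) `→ `? (v0 `∈ v1)) (p ∷ f ∷ [])
        consistent (p∈f , _) p∈⁻f =
          let x , x∈D , i , _ = proj₁ (proj₁ (graph p)) p∈f
          in proj₁ (proj₂ (graph p)) p∈⁻f x x∈D i

        complete : True 𝔐 (`? (v0 `∈ v1) `→ `! (v0 `∈ v1)) (p ∷ f ∷ [])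
        complete ¬p∈⁻f with em {p ∈⁺ f}
        ... | yes p∈f = p∈f , _
        ... | no p∉f = ⊥-elim (¬p∈⁻f (proj₂ (proj₂ (graph p)) λ x x∈D i →
          contradiction (proj₂ (proj₁ (graph p)) (x , x∈D , i , _)) p∉f))

      opaque
        unfolding Maps IsCounting

        graph-counting : IsRlm D A → (∀ {x y z} → R x z → R y z → x ≡ y) →
          (∀ {x} → InRlm A x → Σ Carrier λ y → R x y) → IsCounting f A
        graph-counting {A} D-rlm R-injective R-total =
          ( ( graph-classical
            , (λ p p∈f → let x , _ , (y , π , _) , _ = proj₁ (proj₁ (graph p)) p∈f in x , y , π)
            , λ x y z (m , m′) → R-functional (proj₂ (maps⇒ m)) (proj₂ (maps⇒ m′)) , _)
          , λ x y z (m , m′) → R-injective (proj₂ (maps⇒ m)) (proj₂ (maps⇒ m′)) , _)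
          , D , D-rlm , λ x →
            ( (λ x∈D → let y , r = R-total (proj₁ (proj₁ (D-rlm x)) x∈D) in y , maps⇐ x∈D r)
            , λ (_ , m) → proj₁ (maps⇒ m))
            -- Falsity half of D = dom(f): no pair starting at a nonmember of `D` is truly in `f`,
            -- and `f` is classical.
            , (λ x∈⁻D y p π → classical-nonmember graph-classical
                λ p∈f → inconsistent x∈⁻D (proj₁ (maps⇒ (p , π , p∈f))))
            , λ i → nonmember i
          where
          inconsistent : x ∈⁻ D → x ∈⁺ D → ⊥ {ℓ}
          inconsistent x∈⁻D x∈D with proj₁ (proj₂ (D-rlm _)) x∈⁻D | proj₁ (proj₁ (D-rlm _)) x∈D
          ... | x∉A , _       | inj₁ (x∈A , _) = x∉A x∈A
          ... | _ , x∈⁻A , _  | inj₂ x∉⁻A      = x∉⁻A x∈⁻A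

          -- If `x` were in rlm(A), totality of `R` would put some pair (x,y) truly into `f`,
          -- although all such pairs are false of the classical `f`.
          nonmember : (∀ y p → IsPair p x y → p ∈⁻ f) → x ∈⁻ D
          nonmember {x} i = proj₂ (proj₂ (D-rlm x)) (x∉A , x∈⁻A , _)
            where
            x∉rlm : InRlm A x → ⊥ {ℓ}
            x∉rlm j =
              let y , r = R-total j
                  p , π , p∈f = maps⇐ (proj₂ (proj₁ (D-rlm x)) j) r
              in proj₁ (graph-classical p) (p∈f , _) (i y p π)

            x∉A : x ∈⁺ A → ⊥ {ℓ}
            x∉A x∈A = x∉rlm (inj₁ (x∈A , _))

            x∈⁻A : x ∈⁻ A
            x∈⁻A = [ id , (λ j → ⊥-elim (x∉rlm j)) ] (nonmember-or-inRlm A x)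

  -- The identity counting.

  identity-counting : ∀ A → Σ Carrier λ f → IsCounting f A × IsImage A f A
  identity-counting A =
    let D , D-rlm = rlm-exists A
        -- The relation is `flip _≡_` because the equation in the Replacement formula below reads y
        -- = x.
        R-functional = λ {x y z} (r : y ≡ x) (s : z ≡ x) → trans r (sym s)
        R-injective = λ {x y z} (r : z ≡ x) (s : z ≡ y) → trans (sym r) s
        f , graph = axiom (replacement {0} (`∃ (v2 `=⟦ pair v1 v0 ⟧ `& v0 `= v1))) D
          λ p q x _ → inGraph-functional (flip _≡_) R-functional
        maps-self = λ {x} (i : InRlm A x) →
          maps⇐ (flip _≡_) R-functional graph (proj₂ (proj₁ (D-rlm x)) i) refl
        diagonal = λ {x y} (m : Maps f x y) → proj₂ (maps⇒ (flip _≡_) R-functional graph m)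
    in f
     , graph-counting (flip _≡_) R-functional graph D-rlm R-injective (λ {x} _ → x , refl)
     , λ y →
       ( (λ y∈A → y , maps-self (inj₁ (y∈A , _)) , y∈A)
       , λ (x , m , x∈A) → subst (_∈⁺ A) (sym (diagonal m)) x∈A)
       , (λ y∈⁻A x m → subst (_∈⁻ A) (diagonal m) y∈⁻A)
       , λ i → [ id , (λ j → i y (maps-self j)) ] (nonmember-or-inRlm A y)

  -- The composite h ∘ g⁻¹ ∘ f and its image.

  Composite : Carrier → Carrier → Carrier → Carrier → Carrier → Set ℓ
  Composite f g h x y =
    Σ Carrier λ z → Σ Carrier λ w → Maps f x z × Maps g w z × Maps h w y

  opaque
    unfolding Maps

    -- The hypotheses say that f[A] lies in `Z` in truth and in falsity, so Comprehension from `Z`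
    -- loses nothing, and the inclusion in `Z` comes with it.
    image-exists : ∀ f A Z →
      (∀ {x y} → Maps f x y → x ∈⁺ A → y ∈⁺ Z) →
      (∀ {x y} → Maps f x y → y ∈⁻ Z → x ∈⁻ A) →
      Σ Carrier λ X → IsImage X f A × X ⊆⁺ Z
    image-exists f A Z member nonmember =
      let X , X-spec = axiom (comprehension {2} (image v1 v2)) A f Z
      in X
       , (λ y →
           let (m , m′) , n , n′ = X-spec y in
           ( proj₂ ∘ m
           , λ i → let _ , l , x∈A = i in m′ (member l x∈A , i))
           , [ (λ y∈⁻Z x l → nonmember l y∈⁻Z) , id ] ∘ n
           , n′ ∘ inj₂)
       , λ y → proj₁ ∘ proj₁ (proj₁ (X-spec y)) , proj₂ (proj₂ (X-spec y)) ∘ inj₁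

    composition-graph : ∀ f g h D → let R = Composite f g h in
      (∀ {x y y′} → R x y → R x y′ → y ≡ y′) → Σ Carrier λ k → IsGraph R k D
    composition-graph f g h D functional =
      axiom (replacement {3} (`∃ (v2 `=⟦ pair v1 v0 ⟧ `&
          -- Here `v0` is w, `v1` is z, `v2` is y and `# 3` is x; `# 6`, `# 7`, `# 8` are f, g, h,
          -- whose parameters are supplied outermost first.
          (`∃ `∃ (⟨ # 3 , v1 ⟩`∈ # 6 `∧ ⟨ v0 , v1 ⟩`∈ # 7 `∧ ⟨ v0 , v2 ⟩`∈ # 8)))))
        h g f D λ p q x _ → inGraph-functional (Composite f g h) functional

  module Embedding (f-counts : IsCounting f A) (g-counts : IsCounting g B)
                   (X-image : IsImage X f A) (Y-image : IsImage Y g B) (X⊆Y : X ⊆⁺ Y) where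

    image-member : Maps f x z → x ∈⁺ A → Σ Carrier λ w → Maps g w z × w ∈⁺ B
    image-member {z = z} m x∈A =
      proj₁ (proj₁ (Y-image z)) (proj₁ (X⊆Y z) (proj₂ (proj₁ (X-image z)) (_ , m , x∈A)))

    member : Maps f x z → Maps g w z → x ∈⁺ A → w ∈⁺ B
    member m n x∈A =
      let w , n′ , w∈B = image-member m x∈A
      in subst (_∈⁺ B) (injective g-counts n′ n) w∈B

    -- As `g` is injective, `w` is the only preimage of `z`, so `z ∈⁻ Y`. The falsity half of the
    -- inclusion gives `z ∈⁻ X`, which makes every preimage of `z` under `f` a nonmember of `A`.
    nonmember : Maps f x z → Maps g w z → w ∈⁻ B → x ∈⁻ A
    nonmember {z = z} m n w∈⁻B =
      proj₁ (proj₂ (X-image z)) (proj₂ (X⊆Y z) (proj₂ (proj₂ (Y-image z))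
        λ w n′ → subst (_∈⁻ B) (injective g-counts n n′) w∈⁻B)) _ m

    -- The inclusion of images forces f[rlm(A)] into the range of `g`. For a member of `A` this is
    -- the truth half. For `x` not a nonmember, a value `z` outside the range of `g` would satisfy
    -- `z ∈⁻ Y` vacuously, hence `z ∈⁻ X` and `x ∈⁻ A`.
    match : InRlm A x → Σ Carrier λ z → Σ Carrier λ w → Maps f x z × Maps g w z
    match i with total f-counts i
    match (inj₁ (x∈A , _)) | z , m =
      let w , n , _ = image-member m x∈A
      in z , w , m , n
    match {x} (inj₂ x∉⁻A) | z , m with em {Σ Carrier λ w → Maps g w z}
    ... | yes (w , n) = z , w , m , n
    ... | no z∉range = ⊥-elim (x∉⁻A (proj₁ (proj₂ (X-image z)) (proj₂ (X⊆Y z)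
            (proj₂ (proj₂ (Y-image z)) λ w n → contradiction (w , n) z∉range)) x m))

    module _ (h-counts : IsCounting h B) where

      composite-functional : Composite f g h x y → Composite f g h x y′ → y ≡ y′
      composite-functional (_ , _ , i , j , k) (_ , _ , i′ , j′ , k′)
        with refl ← functional f-counts i i′ with refl ← injective g-counts j j′
        = functional h-counts k k′

      composite-injective : Composite f g h x y → Composite f g h x′ y → x ≡ x′
      composite-injective (_ , _ , i , j , k) (_ , _ , i′ , j′ , k′)
        with refl ← injective h-counts k k′ with refl ← functional g-counts j j′
        = injective f-counts i i′

      composite-total : InRlm A x → Σ Carrier λ y → Composite f g h x y
      composite-total i =
        let z , w , m , n = match i
            y , o = total h-counts (inRlm g-counts n)
        in y , z , w , m , n , o

      composite-counting : Σ Carrier λ k →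
        IsCounting k A × (∀ x y → Maps k x y ↔ Composite f g h x y)
      composite-counting =
        let D , D-rlm = rlm-exists A
            k , graph = composition-graph f g h D composite-functional
            R = Composite f g h
        in k
         , graph-counting R composite-functional graph D-rlm composite-injective composite-total
         , λ x y → (λ m → proj₂ (maps⇒ R composite-functional graph m))
                 , λ (z , w , m , n) → maps⇐ R composite-functional graph
                     (proj₂ (proj₁ (D-rlm x)) (inRlm f-counts m)) (z , w , m , n)

      -- The image h[B] is itself the bounding set from which the image of the composite is cut out.
      composite-image : IsImage Z h B → Σ Carrier λ k → IsCounting k A ×
        Σ Carrier λ Z′ → IsImage Z′ k A × Z′ ⊆⁺ Z
      composite-image Z-image =
        let k , k-counts , k-maps = composite-counting
        in k , k-counts , image-exists k A _
          (λ {x} {y} l x∈A →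
            let _ , w , m , n , o = proj₁ (k-maps x y) l
            in proj₂ (proj₁ (Z-image y)) (w , o , member m n x∈A))
          (λ {x} {y} l y∈⁻Z →
            let _ , w , m , n , o = proj₁ (k-maps x y) l
            in nonmember m n (proj₁ (proj₂ (Z-image y)) y∈⁻Z w o))

  -- Transfer of countings, and invariance of `≅` and `≼`.

  Recountable : Carrier → Carrier → Set ℓ
  Recountable A B = ∀ {h} → IsCounting h B →
    Σ Carrier λ k → IsCounting k A × (∀ {Z} → IsImage Z h B → IsImage Z k A)

  ⊆⁺-refl : X ⊆⁺ X
  ⊆⁺-refl x = id , id

  -- Equality of the images gives an embedding in each direction: `F` builds `k`, and `G` shows that
  -- every value of `h` is a value of `k`, which upgrades the inclusion of images to equality.
  equal-images-recountable : IsCounting f A → IsCounting g B →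
    IsImage X f A → IsImage X g B → Recountable A B
  equal-images-recountable {f} {A} {g} {B} f-counts g-counts f-image g-image {h} h-counts =
    k , k-counts , λ Z-image y →
      let (i , i′) , j , j′ = Z-image y in
      ( (λ y∈Z →
          let w , o , w∈B = i y∈Z
              x , _ , m , n , l = preimage o
          in x , l , G.member n m w∈B)
      , λ (x , l , x∈A) →
          let _ , w , m , n , o = proj₁ (k-maps x y) l
          in i′ (w , o , F.member m n x∈A))
      , (λ y∈⁻Z x l →
          let _ , w , m , n , o = proj₁ (k-maps x y) l
          in F.nonmember m n (j y∈⁻Z w o))
      , λ q → j′ λ w o →
          let x , _ , m , n , l = preimage o
          in G.nonmember n m (q x l)
    where
    module F = Embedding f-counts g-counts f-image g-image ⊆⁺-refl
    module G = Embedding g-counts f-counts g-image f-image ⊆⁺-refl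

    k : Carrier
    k = proj₁ (F.composite-counting h-counts)

    k-counts : IsCounting k A
    k-counts = proj₁ (proj₂ (F.composite-counting h-counts))

    k-maps : ∀ x y → Maps k x y ↔ Composite f g h x y
    k-maps = proj₂ (proj₂ (F.composite-counting h-counts))

    preimage : Maps h w y →
      Σ Carrier λ x → Σ Carrier λ z → Maps f x z × Maps g w z × Maps k x y
    preimage {w} {y} o =
      -- Matching from the side of `B` inverts the composite at `w`.
      let z , x , n , m = G.match (inRlm h-counts o)
      in x , z , m , n , proj₂ (k-maps x y) (z , w , m , n , o)

  -- What `≅` and `≼` evaluate to, with the final comparison of images as the parameter `S`: `_≡_`
  -- or `_⊆⁺_` for truth, `_=⁻_` or `_⊆⁻_` for falsity.
  CompareTrue CompareFalse : (Carrier → Carrier → Set ℓ) → Carrier → Carrier → Set ℓ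
  CompareTrue S A B =
    Σ Carrier λ f → IsCounting f A × Σ Carrier λ g → IsCounting g B ×
    Σ Carrier λ X → IsImage X f A × Σ Carrier λ Y → IsImage Y g B × S X Y
  CompareFalse S A B =
    ∀ f → IsCounting f A → ∀ g → IsCounting g B →
    ∀ X → IsImage X f A → ∀ Y → IsImage Y g B → S X Y

  module _ (S : Carrier → Carrier → Set ℓ) where

    CompareTrue-flip : CompareTrue S A B → CompareTrue (flip S) B A
    CompareTrue-flip (f , α , g , β , X , γ , Y , δ , i) = g , β , f , α , Y , δ , X , γ , i

    CompareFalse-flip : CompareFalse S A B → CompareFalse (flip S) B A
    CompareFalse-flip H g β f α Y δ X γ = H f α g β X γ Y δ

    CompareTrue-recount : Recountable B A → CompareTrue S A C → CompareTrue S B C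
    CompareTrue-recount r (f , α , g , β , X , γ , i) =
      let k , κ , ι = r α in k , κ , g , β , X , ι γ , i

    -- Falsity is universal over countings where truth is existential, so recounting is needed in
    -- the opposite direction.
    CompareFalse-recount : Recountable A B → CompareFalse S A C → CompareFalse S B C
    CompareFalse-recount r H f α g β X γ =
      let k , κ , ι = r α in H k κ g β X (ι γ)

  ≅-recountable : CompareTrue _≡_ A B → Recountable A B
  ≅-recountable (_ , α , _ , β , _ , γ , _ , δ , refl) = equal-images-recountable α β γ δ

  ≅-reflexive : ∀ A → CompareTrue _≡_ A A
  ≅-reflexive A =
    let f , α , γ = identity-counting A in f , α , f , α , A , γ , A , γ , refl

  ≅-symmetric : CompareTrue _≡_ A B → CompareTrue _≡_ B A
  ≅-symmetric (f , α , g , β , X , γ , Y , δ , i) = g , β , f , α , Y , δ , X , γ , sym i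

  ≇-symmetric : CompareFalse _=⁻_ A B → CompareFalse _=⁻_ B A
  ≇-symmetric H g β f α Y δ X γ = =⁻-sym (H f α g β X γ Y δ)

  ≅-congruentˡ : ∀ S S′ → CompareTrue _≡_ A B →
    (CompareTrue S A C ↔ CompareTrue S B C) × (CompareFalse S′ A C ↔ CompareFalse S′ B C)
  ≅-congruentˡ S S′ e =
    let r = ≅-recountable e
        r′ = ≅-recountable (≅-symmetric e)
    in (CompareTrue-recount S r′ , CompareTrue-recount S r)
     , CompareFalse-recount S′ r , CompareFalse-recount S′ r′

  -- Reduced to the other argument by flipping the comparison of images.
  ≅-congruentʳ : ∀ S S′ → CompareTrue _≡_ A B →
    (CompareTrue S C A ↔ CompareTrue S C B) × (CompareFalse S′ C A ↔ CompareFalse S′ C B)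
  ≅-congruentʳ S S′ e =
    let (i , i′) , j , j′ = ≅-congruentˡ (flip S) (flip S′) e
    in ( CompareTrue-flip (flip S) ∘ i ∘ CompareTrue-flip S
       , CompareTrue-flip (flip S) ∘ i′ ∘ CompareTrue-flip S)
     , CompareFalse-flip (flip S′) ∘ j ∘ CompareFalse-flip S′
     , CompareFalse-flip (flip S′) ∘ j′ ∘ CompareFalse-flip S′

  ≼-transitive : CompareTrue _⊆⁺_ A B → CompareTrue _⊆⁺_ B C → CompareTrue _⊆⁺_ A C
  ≼-transitive (f , f-counts , g , g-counts , X , X-image , Y , Y-image , X⊆Y)
               (h , h-counts , j , j-counts , Z , Z-image , W , W-image , Z⊆W) =
    -- The two hypotheses may count `B` differently; the counting `h` from the second is pulled back
    -- to `A` along the first.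
    let k , k-counts , Z′ , Z′-image , Z′⊆Z =
          Embedding.composite-image f-counts g-counts X-image Y-image X⊆Y h-counts Z-image
    in k , k-counts , j , j-counts , Z′ , Z′-image , W , W-image
     , λ x → proj₁ (Z⊆W x) ∘ proj₁ (Z′⊆Z x) , proj₂ (Z′⊆Z x) ∘ proj₂ (Z⊆W x)

  -- Return to formulas, by definitional unfolding.

  opaque
    unfolding Maps IsCounting

    ≅-reflexive-true : True 𝔐 (`∀ v0 `≅ v0) []
    ≅-reflexive-true A = ≅-reflexive A

    ≅-symmetric-true : True 𝔐 (`∀ `∀ (v1 `≅ v0 `⇔ v0 `≅ v1)) []
    ≅-symmetric-true A B =
      (≅-symmetric {A} {B} , ≅-symmetric {B} {A}) , ≇-symmetric {A} {B} , ≇-symmetric {B} {A}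

    ≅-congruent-true : True 𝔐 (`∀ `∀ `∀ (v2 `≅ v1 `→ (v2 `≅ v0 `⇔ v1 `≅ v0))) []
    ≅-congruent-true A B C = ≅-congruentˡ {A} {B} {C} _≡_ _=⁻_

    ≼-congruentˡ-true : True 𝔐 (`∀ `∀ `∀ (v2 `≅ v1 `→ (v2 `≼ v0 `⇔ v1 `≼ v0))) []
    ≼-congruentˡ-true A B C = ≅-congruentˡ {A} {B} {C} _⊆⁺_ _⊆⁻_

    ≼-congruentʳ-true : True 𝔐 (`∀ `∀ `∀ (v2 `≅ v1 `→ (v0 `≼ v2 `⇔ v0 `≼ v1))) []
    ≼-congruentʳ-true A B C = ≅-congruentʳ {A} {B} {C} _⊆⁺_ _⊆⁻_

    ≼-transitive-true : True 𝔐 (`∀ `∀ `∀ ((v2 `≼ v1 `∧ v1 `≼ v0) `→ v2 `≼ v0)) []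
    ≼-transitive-true A B C (i , j) = ≼-transitive {A} {B} {C} i j

theorem4p3 : ∀ {ℓ} → ExcludedMiddle ℓ →
    (BZFC ⊨[ ℓ ] `∀ v0 `≅ v0)
    × (BZFC ⊨[ ℓ ] `∀ `∀ (v1 `≅ v0 `⇔ v0 `≅ v1))
    × (BZFC ⊨[ ℓ ] `∀ `∀ `∀ (v2 `≅ v1 `→ (v2 `≅ v0 `⇔ v1 `≅ v0)))
    × (BZFC ⊨[ ℓ ] `∀ `∀ `∀ (v2 `≅ v1 `→ (v2 `≼ v0 `⇔ v1 `≼ v0)))
    × (BZFC ⊨[ ℓ ] `∀ `∀ `∀ (v2 `≅ v1 `→ (v0 `≼ v2 `⇔ v0 `≼ v1)))
    × (BZFC ⊨[ ℓ ] `∀ `∀ `∀ ((v2 `≼ v1 `∧ v1 `≼ v0) `→ v2 `≼ v0))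
theorem4p3 em =
    ≅-reflexive-true em
  , ≅-symmetric-true em
  , ≅-congruent-true em
  , ≼-congruentˡ-true em
  , ≼-congruentʳ-true em
  , ≼-transitive-true em
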